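{- For every positive integer $k$ there is $n_0$ such that for all $n \geq n_0$, $s(n, \mathcal{C}_k) \geq \binom{n}{2} - 5k n^{3/2}$. This holds both when Mini moves first and when Max moves first.
   Context: Let $\mathcal{P}$ be a monotone increasing property of graphs on vertex set $[n]$. An edge $e \in \binom{[n]}{2}\setminus E(G)$ is legal with respect to a graph $G \notin \mathcal{P}$ if $G \cup \{e\} \notin \mathcal{P}$. The saturation game $(n,\mathcal{P})$: starting from the empty graph on $[n]$, two players, Mini and Max, alternately add a legal edge to the current graph $G$. The game ends when no legal edge exists, i.e. when $G$ is saturated with respect to $\mathcal{P}$. Max wants to maximize the number of edges of the final graph and Mini wants to minimize it. The score $s(n,\mathcal{P})$ is the number of edges of the final graph under optimal play by both players; it may depend on which player moves first. $\mathcal{C}_k$ denotes the property of being $k$-vertex-connected (on all $n$ vertices). -}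

module Defs where

open import Data.Nat as ℕ using (ℕ; zero; suc; _≤_)
open import Data.Fin as Fin using (Fin)
open import Data.Fin.Subset using (Subset; ∣_∣) renaming (_∈_ to _∈ₛ_; _∉_ to _∉ₛ_)
open import Data.Product using (Σ; ∃; _×_; _,_)
open import Data.Sum using (_⊎_)
open import Data.List using (List; []; _∷_; length)
open import Data.List.Membership.Propositional using (_∈_)
open import Relation.Nullary using (¬_)

-- A graph on vertex set [n] = Fin n, given by the list of its edges
-- (the edges added so far in the game); the pair (u , v) stands for {u , v}.
Graph : ℕ → Set
Graph n = List (Fin n × Fin n)

module _ {n : ℕ} where

  Adj : Graph n → Fin n → Fin n → Set
  Adj G u v = ((u , v) ∈ G) ⊎ ((v , u) ∈ G)

  -- u reaches v in G − S by a walk all of whose vertices avoid S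
  -- (the start u is assumed outside S by the user).
  data Reach (G : Graph n) (S : Subset n) : Fin n → Fin n → Set where
    here : ∀ {u} → Reach G S u u
    step : ∀ {u w v} → Adj G u w → w ∉ₛ S → Reach G S w v → Reach G S u v

  KConnected : ℕ → Graph n → Set
  KConnected k G = (k ℕ.< n) ×
    ((S : Subset n) → ∣ S ∣ ℕ.< k →
       ∀ u v → u ∉ₛ S → v ∉ₛ S → Reach G S u v)

  Legal : ℕ → Graph n → Fin n → Fin n → Set
  Legal k G u v = (u Fin.< v) × ¬ Adj G u v × ¬ KConnected k ((u , v) ∷ G)

  Saturated : ℕ → Graph n → Set
  Saturated k G = ∀ u v → ¬ Legal k G u v

data Player : Set where
  Mini Max : Player

-- MaxForces k n p G t : in the saturation game (n, C_k) from position G with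
-- player p to move, Max has a strategy guaranteeing the final graph has at
-- least t edges (against every strategy of Mini).  Since the game is finite
-- with perfect information, this holds iff the score (minimax value) is ≥ t.
data MaxForces (k n : ℕ) : Player → Graph n → ℕ → Set where
  maxEnd   : ∀ {G t} → Saturated k G → t ≤ length G → MaxForces k n Max G t
  maxMove  : ∀ {G t} u v → Legal k G u v →
             MaxForces k n Mini ((u , v) ∷ G) t → MaxForces k n Max G t
  miniTurn : ∀ {G t} →
             (Saturated k G → t ≤ length G) →
             (∀ u v → Legal k G u v → MaxForces k n Max ((u , v) ∷ G) t) →
             MaxForces k n Mini G t

{-# OPTIONS --safe #-}

-- A saturated graph consists of two cliques sharing a cut of fewer than k
-- vertices, so Max has to keep one of the two sides below 5 k √n.  With
-- q ≈ √n / 2 he first builds a complete bipartite graph between k hubs and q k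
-- targets, the latter split into q blocks of size k, and assigns a block to
-- each vertex so that every block serves about n / q vertices.  A vertex joined
-- to its whole block belongs to the core, which no cut of fewer than k vertices
-- can split.  Afterwards Max answers each edge of Mini by joining one of its
-- endpoints outside the core to a new vertex of its block.  If B is the side of
-- a cut S that avoids the core, all answers at B go to targets in S, so there
-- are at most |S| n / q of them, and hence O(k² q + k n / q) edges meet B.
-- The answering stops only when the next edge would make the graph
-- k-connected; then every vertex of B has degree at least k, up to that one
-- edge, so B is small for every cut, and it remains so in the rest of the game.
module Submission where

open import Defs
open import Data.Nat using (ℕ; _≤_; _∸_; _*_; _^_)
open import Data.Nat.Combinatorics using (_C_)
open import Data.Product using (∃; _×_)
open import Data.List using ([])
open import Data.Nat as ℕ using (zero; suc; _+_; _<_; z≤n; s≤s; s≤s⁻¹)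
open import Data.Nat.Combinatorics using (nC1≡n; nCk+nC[k+1]≡[n+1]C[k+1])
open import Data.Nat.ListAction using () renaming (sum to sumₗ)
open import Data.Nat.Properties hiding (suc-injective; _≟_; <-cmp)
open import Data.Nat.Tactic.RingSolver using (solve-∀)
open import Data.Fin as Fin using (Fin; zero; suc; toℕ)
open import Data.Fin.Properties using (any?; <-cmp; suc-injective; toℕ<n; toℕ-injective; toℕ-fromℕ<; toℕ-inject≤; inject≤-injective; toℕ-↑ˡ; toℕ-↑ʳ; ↑ˡ-injective; ↑ʳ-injective; splitAt⁻¹-↑ˡ; splitAt⁻¹-↑ʳ; remQuot-combine; combine-remQuot; combine-injective) renaming (_≟_ to _≟ᶠ_; _<?_ to _<ᶠ?_)
open import Data.Fin.Subset using (Subset; ∣_∣; inside; outside; _∪_; ⁅_⁆) renaming (_∈_ to _∈ₛ_; _∉_ to _∉ₛ_)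
open import Data.Fin.Subset.Properties using (_∈?_; anySubset?; p⊂q⇒∣p∣<∣q∣; ∣p∣≤n; p⊆p∪q; q⊆p∪q; x∈p∪q⁻; x∈⁅x⁆; x∈⁅y⁆⇒x≡y)
open import Data.List as List using (List; _∷_; length; cartesianProduct; allFin)
open import Data.List.Properties using (map-cong; length-++; length-map; length-tabulate)
open import Data.List.Membership.Propositional using (_∈_)
open import Data.List.Membership.Propositional.Properties using (∈-cartesianProduct⁺; ∈-allFin)
open import Data.List.Membership.DecPropositional using () renaming (_∈?_ to ∈?-by)
open import Data.List.Relation.Unary.Any using (here; there)
open import Data.Vec using ([]; _∷_; tabulate)
open import Data.Vec.Properties using ([]=⇒lookup; lookup⇒[]=; lookup∘tabulate)
open import Data.Bool using (Bool; true; false; not; if_then_else_) renaming (_≟_ to _≟ᵇ_)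
open import Data.Bool.Properties using (¬-not; not-¬; not-involutive)
open import Data.Maybe using (Maybe; just; nothing)
open import Data.Maybe.Properties using () renaming (≡-dec to Maybe-≡-dec)
open import Data.Product using (_,_; proj₁; proj₂; uncurry)
open import Data.Product.Properties using () renaming (≡-dec to ×-≡-dec)
open import Data.Sum as Sum using (_⊎_; inj₁; inj₂)
open import Data.Empty using (⊥-elim)
open import Function using (_∘_; case_of_)
open import Relation.Binary using (tri<; tri≈; tri>)
open import Relation.Binary.PropositionalEquality
open import Relation.Nullary using (¬_; Dec; yes; no; does)
open import Relation.Nullary.Decidable using (_×-dec_; _⊎-dec_; ¬?; dec-true; decidable-stable)
open import Relation.Unary using (Pred; Decidable)
open import Algebra.Properties.Semiring.Sum +-*-semiring

-- Finite sums

𝟙 : ∀ {p} {P : Set p} → Dec P → ℕ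
𝟙 P? = if does P? then 1 else 0

module _ {p} {P : Set p} where

  𝟙-yes : (P? : Dec P) → P → 𝟙 P? ≡ 1
  𝟙-yes (yes _) _ = refl
  𝟙-yes (no ¬p) p = ⊥-elim (¬p p)

  𝟙-no : (P? : Dec P) → ¬ P → 𝟙 P? ≡ 0
  𝟙-no (yes p) ¬p = ⊥-elim (¬p p)
  𝟙-no (no _) _ = refl

  𝟙≤1 : (P? : Dec P) → 𝟙 P? ≤ 1
  𝟙≤1 (yes _) = ≤-refl
  𝟙≤1 (no _) = z≤n

  𝟙≤ : (P? : Dec P) {m : ℕ} → (P → 1 ≤ m) → 𝟙 P? ≤ m
  𝟙≤ (yes p) h = h p
  𝟙≤ (no _) _ = z≤n

  𝟙*≤ : (P? : Dec P) {m r : ℕ} → (P → m ≤ r) → 𝟙 P? * m ≤ r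
  𝟙*≤ (yes p) {m} h = ≤-trans (≤-reflexive (+-identityʳ m)) (h p)
  𝟙*≤ (no _) _ = z≤n

𝟙-mono : ∀ {p q} {P : Set p} {Q : Set q} (P? : Dec P) (Q? : Dec Q) → (P → Q) → 𝟙 P? ≤ 𝟙 Q?
𝟙-mono P? Q? P⇒Q = 𝟙≤ P? (≤-reflexive ∘ sym ∘ 𝟙-yes Q? ∘ P⇒Q)

δ : ∀ {n} → Fin n → Fin n → ℕ
δ u v = 𝟙 (u ≟ᶠ v)

δ-refl : ∀ {n} (u : Fin n) → δ u u ≡ 1
δ-refl u = 𝟙-yes (u ≟ᶠ u) refl

sum-mono-≤ : ∀ {n} {f g : Fin n → ℕ} → (∀ i → f i ≤ g i) → sum f ≤ sum g
sum-mono-≤ {zero} _ = z≤n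
sum-mono-≤ {suc n} f≤g = +-mono-≤ (f≤g zero) (sum-mono-≤ (f≤g ∘ suc))

sum-const : ∀ n c → sum {n} (λ _ → c) ≡ n * c
sum-const zero c = refl
sum-const (suc n) c = cong (c +_) (sum-const n c)

term≤sum : ∀ {n} (f : Fin n → ℕ) i → f i ≤ sum f
term≤sum f zero = m≤m+n _ _
term≤sum f (suc i) = ≤-trans (term≤sum (f ∘ suc) i) (m≤n+m _ _)

sum-mono-gap : ∀ {n} {f g : Fin n → ℕ} {d} → (∀ i → f i ≤ g i) →
  ∀ i → f i + d ≤ g i → sum f + d ≤ sum g
sum-mono-gap {f = f} {g} {d} f≤g zero gap = begin
  f zero + sum (f ∘ suc) + d   ≡⟨ +-assoc (f zero) _ d ⟩
  f zero + (sum (f ∘ suc) + d) ≡⟨ cong (f zero +_) (+-comm _ d) ⟩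
  f zero + (d + sum (f ∘ suc)) ≡⟨ +-assoc (f zero) d _ ⟨
  f zero + d + sum (f ∘ suc)   ≤⟨ +-mono-≤ gap (sum-mono-≤ (f≤g ∘ suc)) ⟩
  g zero + sum (g ∘ suc)       ∎
  where open ≤-Reasoning
sum-mono-gap {f = f} {g} {d} f≤g (suc i) gap = begin
  f zero + sum (f ∘ suc) + d   ≡⟨ +-assoc (f zero) _ d ⟩
  f zero + (sum (f ∘ suc) + d) ≤⟨ +-mono-≤ (f≤g zero) (sum-mono-gap (f≤g ∘ suc) i gap) ⟩
  g zero + sum (g ∘ suc)       ∎
  where open ≤-Reasoning

sum-δ : ∀ {n} (f : Fin n → ℕ) a → sum (λ v → δ v a * f v) ≡ f a
sum-δ {suc n} f zero = trans (cong₂ _+_ (+-identityʳ (f zero)) (sum-const n 0))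
  (trans (cong (f zero +_) (*-zeroʳ n)) (+-identityʳ (f zero)))
sum-δ f (suc a) = sum-δ (f ∘ suc) a

-- Double counting: write `g (f i)` as a sum over all `v` concentrated at `f i`, then exchange the
-- two sums.
sum-fibres : ∀ {m n} D (f : Fin m → Fin n) (g : Fin n → ℕ) →
  (∀ v → sum (λ i → δ v (f i)) ≤ D) → sum (g ∘ f) ≤ D * sum g
sum-fibres {m} {n} D f g fibre≤D = begin
  sum (λ i → g (f i))                       ≡⟨ sum-cong-≗ (λ i → sum-δ g (f i)) ⟨
  sum (λ i → sum (λ v → δ v (f i) * g v))   ≡⟨ ∑-comm (λ i v → δ v (f i) * g v) ⟩
  sum (λ v → sum (λ i → δ v (f i) * g v))   ≡⟨ sum-cong-≗ (λ v → *-distribʳ-sum (g v) (λ i → δ v (f i))) ⟨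
  sum (λ v → sum (λ i → δ v (f i)) * g v)   ≤⟨ sum-mono-≤ (λ v → *-monoˡ-≤ (g v) (fibre≤D v)) ⟩
  sum (λ v → D * g v)                       ≡⟨ *-distribˡ-sum D g ⟨
  D * sum g                                 ∎
  where open ≤-Reasoning

sum-𝟙≤1 : ∀ {n p} {P : Pred (Fin n) p} (P? : Decidable P) →
  (∀ {i j} → P i → P j → i ≡ j) → sum (λ i → 𝟙 (P? i)) ≤ 1
sum-𝟙≤1 {zero} P? uniq = z≤n
sum-𝟙≤1 {suc n} P? uniq with P? zero
... | yes p₀ = s≤s (≤-trans
  (sum-mono-≤ λ i → ≤-reflexive (𝟙-no (P? (suc i)) λ p → case uniq p₀ p of λ ()))
  (≤-reflexive (trans (sum-const n 0) (*-zeroʳ n))))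
... | no _ = sum-𝟙≤1 (P? ∘ suc) λ p q → suc-injective (uniq p q)

sum-injection : ∀ {m n} (f : Fin m → Fin n) (g : Fin n → ℕ) →
  (∀ {i j} → f i ≡ f j → i ≡ j) → sum (g ∘ f) ≤ sum g
sum-injection f g f-inj = ≤-trans
  (sum-fibres 1 f g λ v → sum-𝟙≤1 (λ i → v ≟ᶠ f i) λ p q → f-inj (trans (sym p) q))
  (≤-reflexive (+-identityʳ _))

sum-↑ˡ-↑ʳ : ∀ m {n} (g : Fin (m + n) → ℕ) →
  sum g ≡ sum (λ i → g (i Fin.↑ˡ n)) + sum (λ j → g (m Fin.↑ʳ j))
sum-↑ˡ-↑ʳ zero g = refl
sum-↑ˡ-↑ʳ (suc m) g = trans (cong (g zero +_) (sum-↑ˡ-↑ʳ m (g ∘ suc))) (sym (+-assoc (g zero) _ _))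

sum-combine : ∀ m {n} (g : Fin (m * n) → ℕ) →
  sum g ≡ sum (λ i → sum (λ j → g (Fin.combine {m} {n} i j)))
sum-combine zero g = refl
sum-combine (suc m) {n} g = trans (sum-↑ˡ-↑ʳ n g)
  (cong (sum (λ j → g (j Fin.↑ˡ (m * n))) +_) (sum-combine m (λ j → g (n Fin.↑ʳ j))))

sum-injection₂ : ∀ {l m n} (f : Fin l → Fin m → Fin n) (g : Fin n → ℕ) →
  (∀ {i j i′ j′} → f i j ≡ f i′ j′ → i ≡ i′ × j ≡ j′) →
  sum (λ i → sum (λ j → g (f i j))) ≤ sum g
sum-injection₂ {l} {m} f g f-inj = begin
  sum (λ i → sum (λ j → g (f i j)))
    ≡⟨ sum-cong-≗ (λ i → sum-cong-≗ (λ j → cong (g ∘ uncurry f) (remQuot-combine i j))) ⟨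
  sum (λ i → sum (λ j → g (f′ (Fin.combine {l} {m} i j))))
    ≡⟨ sum-combine l (g ∘ f′) ⟨
  sum (g ∘ f′)
    ≤⟨ sum-injection f′ g f′-inj ⟩
  sum g ∎
  where
  open ≤-Reasoning
  f′ : Fin (l * m) → Fin _
  f′ = uncurry f ∘ Fin.remQuot m

  f′-inj : ∀ {x y} → f′ x ≡ f′ y → x ≡ y
  f′-inj {x} {y} eq with f-inj eq
  ... | p , q = trans (sym (combine-remQuot {l} m x))
    (trans (cong₂ Fin.combine p q) (combine-remQuot {l} m y))

∑ₗ : ∀ {a} {A : Set a} → (A → ℕ) → List A → ℕ
∑ₗ f = sumₗ ∘ List.map f

∑ₗ-≤-length : ∀ {a} {A : Set a} {f : A → ℕ} {c} → (∀ x → f x ≤ c) → ∀ xs → ∑ₗ f xs ≤ List.length xs * c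
∑ₗ-≤-length f≤c [] = z≤n
∑ₗ-≤-length f≤c (x ∷ xs) = +-mono-≤ (f≤c x) (∑ₗ-≤-length f≤c xs)

sum-∑ₗ-comm : ∀ {a} {A : Set a} {n} (f : Fin n → A → ℕ) xs →
  sum (λ v → ∑ₗ (f v) xs) ≡ ∑ₗ (λ x → sum (λ v → f v x)) xs
sum-∑ₗ-comm {n = n} f [] = trans (sum-const n 0) (*-zeroʳ n)
sum-∑ₗ-comm f (x ∷ xs) = trans (∑-distrib-+ (λ v → f v x) (λ v → ∑ₗ (f v) xs))
  (cong (sum (λ v → f v x) +_) (sum-∑ₗ-comm f xs))

∑ₗ-∈ : ∀ {a} {A : Set a} (f : A → ℕ) {x xs} → x ∈ xs → f x ≤ ∑ₗ f xs
∑ₗ-∈ f (here refl) = m≤m+n _ _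
∑ₗ-∈ f (there x∈xs) = ≤-trans (∑ₗ-∈ f x∈xs) (m≤n+m _ _)

∑ₗ-cong : ∀ {a} {A : Set a} {f g : A → ℕ} → f ≗ g → ∀ xs → ∑ₗ f xs ≡ ∑ₗ g xs
∑ₗ-cong f≗g xs = cong sumₗ (map-cong f≗g xs)

∑ₗ-const : ∀ {a} {A : Set a} {f : A → ℕ} {c} → (∀ x → f x ≡ c) → ∀ xs → ∑ₗ f xs ≡ length xs * c
∑ₗ-const f≡c [] = refl
∑ₗ-const f≡c (x ∷ xs) = cong₂ _+_ (f≡c x) (∑ₗ-const f≡c xs)

∑ₗ-*ʳ : ∀ {a} {A : Set a} (f : A → ℕ) c xs → ∑ₗ f xs * c ≡ ∑ₗ (λ x → f x * c) xs
∑ₗ-*ʳ f c [] = refl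
∑ₗ-*ʳ f c (x ∷ xs) = trans (*-distribʳ-+ c (f x) _) (cong (f x * c +_) (∑ₗ-*ʳ f c xs))

∣S∣≡sum : ∀ {n} (S : Subset n) → ∣ S ∣ ≡ sum (λ v → 𝟙 (v ∈? S))
∣S∣≡sum [] = refl
∣S∣≡sum (inside ∷ S) = cong suc (∣S∣≡sum S)
∣S∣≡sum (outside ∷ S) = ∣S∣≡sum S

-- Separations and decidability of k-connectivity

2*nC2 : ∀ n → 2 * (n C 2) + n ≡ n * n
2*nC2 zero = refl
2*nC2 (suc n) = begin
  2 * (suc n C 2) + suc n           ≡⟨ cong (λ c → 2 * c + suc n) (nCk+nC[k+1]≡[n+1]C[k+1] n 1) ⟨
  2 * (n C 1 + n C 2) + suc n       ≡⟨ cong (λ c → 2 * (c + n C 2) + suc n) (nC1≡n n) ⟩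
  2 * (n + n C 2) + suc n           ≡⟨ regroup n (n C 2) ⟩
  (2 * (n C 2) + n) + (2 * n + 1)   ≡⟨ cong (_+ (2 * n + 1)) (2*nC2 n) ⟩
  n * n + (2 * n + 1)               ≡⟨ square n ⟩
  suc n * suc n                     ∎
  where
  open ≡-Reasoning
  regroup : ∀ n c → 2 * (n + c) + suc n ≡ (2 * c + n) + (2 * n + 1)
  regroup = solve-∀
  square : ∀ n → n * n + (2 * n + 1) ≡ suc n * suc n
  square = solve-∀

_≟ᶜ_ : (c d : Maybe Bool) → Dec (c ≡ d)
_≟ᶜ_ = Maybe-≡-dec _≟ᵇ_

module _ {n : ℕ} where

  adj? : (G : Graph n) → ∀ u v → Dec (Adj G u v)
  adj? G u v = ∈?-by (×-≡-dec _≟ᶠ_ _≟ᶠ_) (u , v) G ⊎-dec ∈?-by (×-≡-dec _≟ᶠ_ _≟ᶠ_) (v , u) G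

  adj-sym : ∀ {G : Graph n} {u v} → Adj G u v → Adj G v u
  adj-sym = Sum.swap

  adj-∷ : ∀ {G : Graph n} {e u v} → Adj G u v → Adj (e ∷ G) u v
  adj-∷ = Sum.map there there

  -- A vertex cut with the two sides it leaves: nothing marks the cut.
  Colouring : Set
  Colouring = Fin n → Maybe Bool

  class : Colouring → Maybe Bool → Fin n → ℕ
  class col c v = 𝟙 (col v ≟ᶜ c)

  size : Colouring → Maybe Bool → ℕ
  size col c = sum (class col c)

  -- Either side may be empty or consist of several components; `Nontrivial` is asked for
  -- separately.
  record Separates (k : ℕ) (G : Graph n) (col : Colouring) : Set where
    field
      cut<k     : size col nothing < k
      uncrossed : ∀ {u v a b} → Adj G u v → col u ≡ just a → col v ≡ just b → a ≡ b

  open Separates public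

  Nontrivial : Colouring → Set
  Nontrivial col = (∃ λ u → col u ≡ just true) × (∃ λ v → col v ≡ just false)

  separates-tail : ∀ {k G e col} → Separates k (e ∷ G) col → Separates k G col
  separates-tail sep = record { cut<k = cut<k sep ; uncrossed = λ a → uncrossed sep (adj-∷ a) }

  separates-∷ : ∀ {k G u v col} → Separates k G col →
    (∀ {a b} → col u ≡ just a → col v ≡ just b → a ≡ b) → Separates k ((u , v) ∷ G) col
  separates-∷ sep ok = record
    { cut<k = cut<k sep
    ; uncrossed = λ where
        (inj₁ (here refl)) p q → ok p q
        (inj₁ (there m)) p q → uncrossed sep (inj₁ m) p q
        (inj₂ (here refl)) p q → sym (ok q p)
        (inj₂ (there m)) p q → uncrossed sep (inj₂ m) p q
    }

  module _ {k : ℕ} {G : Graph n} {col : Colouring} (sep : Separates k G col) where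

    private
      S : Subset n
      S = tabulate λ v → does (col v ≟ᶜ nothing)

      ∈S⇒cut : ∀ {v} → v ∈ₛ S → col v ≡ nothing
      ∈S⇒cut {v} v∈S with trans (sym (lookup∘tabulate (λ v → does (col v ≟ᶜ nothing)) v)) ([]=⇒lookup v∈S)
      ... | d with col v ≟ᶜ nothing
      ... | yes p = p
      ∈S⇒cut {v} v∈S | () | no _

      cut⇒∈S : ∀ {v} → col v ≡ nothing → v ∈ₛ S
      cut⇒∈S {v} p = lookup⇒[]= v S
        (trans (lookup∘tabulate (λ v → does (col v ≟ᶜ nothing)) v) (dec-true (col v ≟ᶜ nothing) p))

      ∣S∣<k : ∣ S ∣ < k
      ∣S∣<k = ≤-<-trans
        (≤-trans (≤-reflexive (∣S∣≡sum S)) (sum-mono-≤ λ v → 𝟙-mono (v ∈? S) (col v ≟ᶜ nothing) ∈S⇒cut))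
        (cut<k sep)

      reach-colour : ∀ {u v a} → Reach G S u v → col u ≡ just a → col v ≡ just a
      reach-colour here p = p
      reach-colour (step {w = w} adj w∉S r) p with col w in eq
      ... | nothing = ⊥-elim (w∉S (cut⇒∈S eq))
      ... | just b = reach-colour r (trans eq (cong just (sym (uncrossed sep adj p eq))))

      coloured⇒∉S : ∀ {v a} → col v ≡ just a → v ∉ₛ S
      coloured⇒∉S p v∈S with trans (sym p) (∈S⇒cut v∈S)
      ... | ()

    separated⇒¬KConnected : Nontrivial col → ¬ KConnected k G
    separated⇒¬KConnected ((u , pu) , (v , pv)) (_ , conn)
      with trans (sym (reach-colour (conn S ∣S∣<k u v (coloured⇒∉S pu) (coloured⇒∉S pv)) pu)) pv
    ... | ()

  reach-snoc : ∀ {G : Graph n} {S u x y} → Reach G S u x → Adj G x y → y ∉ₛ S → Reach G S u y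
  reach-snoc here a y∉S = step a y∉S here
  reach-snoc (step b w∉S r) a y∉S = step b w∉S (reach-snoc r a y∉S)

  record Component (G : Graph n) (S : Subset n) (u : Fin n) : Set where
    field
      R      : Subset n
      start  : u ∈ₛ R
      sound  : ∀ {x} → x ∈ₛ R → Reach G S u x
      closed : ∀ {x y} → x ∈ₛ R → Adj G x y → y ∉ₛ S → y ∈ₛ R

    complete : ∀ {x y} → x ∈ₛ R → Reach G S x y → y ∈ₛ R
    complete x∈R here = x∈R
    complete x∈R (step a w∉S r) = complete (closed x∈R a w∉S) r

  component : ∀ G S u → Component G S u
  component G S u = grow (suc n) ⁅ u ⁆ (m≤n+m (suc n) ∣ ⁅ u ⁆ ∣) (x∈⁅x⁆ u)
    λ x∈ → subst (Reach G S u) (sym (x∈⁅y⁆⇒x≡y u x∈)) here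
    where
    -- Every round adds a vertex, so `∣ R ∣ + fuel` never falls below its initial value; running out
    -- of fuel would mean more than `n` vertices in `R`.
    grow : ∀ fuel R → n < ∣ R ∣ + fuel → u ∈ₛ R → (∀ {x} → x ∈ₛ R → Reach G S u x) → Component G S u
    grow zero R n< _ _ = ⊥-elim (<⇒≱ n< (≤-trans (≤-reflexive (+-identityʳ ∣ R ∣)) (∣p∣≤n R)))
    grow (suc fuel) R n< u∈R sound
      with any? (λ x → any? (λ y → x ∈? R ×-dec adj? G x y ×-dec ¬? (y ∈? S) ×-dec ¬? (y ∈? R)))
    ... | no stuck = record
      { R = R ; start = u∈R ; sound = sound
      ; closed = λ {x} {y} x∈R a y∉S → decidable-stable (y ∈? R) λ y∉R → stuck (x , y , x∈R , a , y∉S , y∉R) }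
    ... | yes (x , y , x∈R , a , y∉S , y∉R) = grow fuel (R ∪ ⁅ y ⁆)
      (≤-trans n< (≤-trans (≤-reflexive (+-suc ∣ R ∣ fuel)) (+-monoˡ-≤ fuel
        (p⊂q⇒∣p∣<∣q∣ (p⊆p∪q ⁅ y ⁆ , y , q⊆p∪q R ⁅ y ⁆ (x∈⁅x⁆ y) , y∉R)))))
      (p⊆p∪q ⁅ y ⁆ u∈R)
      λ z∈ → case x∈p∪q⁻ R ⁅ y ⁆ z∈ of λ where
        (inj₁ z∈R) → sound z∈R
        (inj₂ z∈y) → subst (Reach G S u) (sym (x∈⁅y⁆⇒x≡y y z∈y)) (reach-snoc (sound x∈R) a y∉S)

  reach? : ∀ G S u v → Dec (Reach G S u v)
  reach? G S u v with v ∈? Component.R (component G S u)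
  ... | yes v∈R = yes (Component.sound (component G S u) v∈R)
  ... | no v∉R = no (v∉R ∘ Component.complete (component G S u) (Component.start (component G S u)))

  componentColouring : ∀ (G : Graph n) S u → Colouring
  componentColouring G S u x with x ∈? S
  ... | yes _ = nothing
  ... | no _ = just (does (x ∈? Component.R (component G S u)))

  -- All `S` are searched for a pair that `S` disconnects. If one is found, the component of `u`
  -- outside `S` is one side and the remaining vertices outside `S` are the other; no edge crosses
  -- since the component is closed.
  connected-or-separated : ∀ {k} → k < n → (G : Graph n) →
    KConnected k G ⊎ ∃ λ col → Separates k G col × Nontrivial col
  connected-or-separated {k} k<n G
    with anySubset? (λ S → (∣ S ∣ ℕ.<? k) ×-dec any? (λ u → any? (λ v →
           ¬? (u ∈? S) ×-dec ¬? (v ∈? S) ×-dec ¬? (reach? G S u v))))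
  ... | no none = inj₁ (k<n , λ S ∣S∣<k u v u∉S v∉S →
    decidable-stable (reach? G S u v) λ ¬r → none (S , ∣S∣<k , u , v , u∉S , v∉S , ¬r))
  ... | yes (S , ∣S∣<k , u , v , u∉S , v∉S , ¬r) = inj₂ (col , sep , (u , col-u) , (v , col-v))
    where
    open Component (component G S u)
    col = componentColouring G S u

    cut⇒∈S : ∀ x → col x ≡ nothing → x ∈ₛ S
    cut⇒∈S x p with x ∈? S
    ... | yes x∈S = x∈S

    col-true : ∀ x → col x ≡ just true → x ∉ₛ S × x ∈ₛ R
    col-true x p with x ∈? S
    ... | no x∉S with x ∈? R
    ... | yes x∈R = x∉S , x∈R

    col-false : ∀ x → col x ≡ just false → x ∉ₛ S × x ∉ₛ R
    col-false x p with x ∈? S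
    ... | no x∉S with x ∈? R
    ... | no x∉R = x∉S , x∉R

    col-u : col u ≡ just true
    col-u with u ∈? S
    ... | yes u∈S = ⊥-elim (u∉S u∈S)
    ... | no _ = cong just (dec-true (u ∈? R) start)

    col-v : col v ≡ just false
    col-v with v ∈? S
    ... | yes v∈S = ⊥-elim (v∉S v∈S)
    ... | no _ with v ∈? R
    ... | yes v∈R = ⊥-elim (¬r (sound v∈R))
    ... | no _ = refl

    consistent : ∀ {x y a b} → Adj G x y → col x ≡ just a → col y ≡ just b → a ≡ b
    consistent {a = true} {true} _ _ _ = refl
    consistent {a = false} {false} _ _ _ = refl
    consistent {x} {y} {true} {false} a p q =
      ⊥-elim (proj₂ (col-false y q) (closed (proj₂ (col-true x p)) a (proj₁ (col-false y q))))
    consistent {x} {y} {false} {true} a p q =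
      ⊥-elim (proj₂ (col-false x p) (closed (proj₂ (col-true y q)) (adj-sym a) (proj₁ (col-false x p))))

    sep : Separates k G col
    sep = record
      { cut<k = ≤-<-trans (≤-trans (sum-mono-≤ λ x → 𝟙-mono (col x ≟ᶜ nothing) (x ∈? S) (cut⇒∈S x))
                                   (≤-reflexive (sym (∣S∣≡sum S)))) ∣S∣<k
      ; uncrossed = consistent
      }

  kConnected? : ∀ k G → Dec (KConnected k G)
  kConnected? k G with k ℕ.<? n
  ... | no k≮n = no (k≮n ∘ proj₁)
  ... | yes k<n with connected-or-separated k<n G
  ... | inj₁ conn = yes conn
  ... | inj₂ (_ , sep , nt) = no (separated⇒¬KConnected sep nt)

  legal? : ∀ k G u v → Dec (Legal k G u v)
  legal? k G u v = (u <ᶠ? v) ×-dec ¬? (adj? G u v) ×-dec ¬? (kConnected? k ((u , v) ∷ G))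

  -- In a complete graph any two vertices are adjacent, so it is k-connected once `k < n`.
  missing-edge : ∀ {k G} → k < n → ¬ KConnected k G → ∃ λ u → ∃ λ v → u Fin.< v × ¬ Adj G u v
  missing-edge {k} {G} k<n ¬conn with any? (λ u → any? (λ v → (u <ᶠ? v) ×-dec ¬? (adj? G u v)))
  ... | yes found = found
  ... | no none = ⊥-elim (¬conn (k<n , reach))
    where
    adj : ∀ {u v} → u Fin.< v → Adj G u v
    adj {u} {v} u<v = decidable-stable (adj? G u v) λ ¬a → none (u , v , u<v , ¬a)

    reach : ∀ S → ∣ S ∣ < k → ∀ u v → u ∉ₛ S → v ∉ₛ S → Reach G S u v
    reach S _ u v _ v∉S with <-cmp u v
    ... | tri< u<v _ _ = step (adj u<v) v∉S here
    ... | tri≈ _ refl _ = here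
    ... | tri> _ _ v<u = step (adj-sym (adj v<u)) v∉S here

  -- A termination measure for the game. It runs over ordered pairs, diagonal included, because only
  -- its strict decrease with each move matters.
  freePairs : Graph n → ℕ
  freePairs G = sum λ u → sum λ v → 𝟙 (¬? (adj? G u v))

  legal⇒freePairs-< : ∀ {k G u v} → Legal k G u v → freePairs ((u , v) ∷ G) < freePairs G
  legal⇒freePairs-< {k} {G} {u} {v} (_ , ¬a , _) = ≤-trans (≤-reflexive (+-comm 1 _))
    (sum-mono-gap (λ x → sum-mono-≤ (mono x)) u
      (sum-mono-gap (mono u) v (≤-reflexive (trans
        (cong (_+ 1) (𝟙-no (¬? (adj? ((u , v) ∷ G) u v)) λ ¬a′ → ¬a′ (inj₁ (here refl))))
        (sym (𝟙-yes (¬? (adj? G u v)) ¬a))))))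
    where
    mono : ∀ x y → 𝟙 (¬? (adj? ((u , v) ∷ G) x y)) ≤ 𝟙 (¬? (adj? G x y))
    mono x y = 𝟙-mono (¬? (adj? ((u , v) ∷ G) x y)) (¬? (adj? G x y)) (_∘ adj-∷)

  -- Degrees and the number of edges of a saturated graph.

  endpoints : (Fin n → ℕ) → Fin n × Fin n → ℕ
  endpoints w (u , v) = w u + w v

  -- Repeated edges count repeatedly and a loop counts twice, so this is an upper bound for the
  -- number of neighbours.
  deg : Graph n → Fin n → ℕ
  deg G v = ∑ₗ (endpoints (δ v)) G

  -- Numerical form of `Adj` for a single edge. Products of `δ` let a sum over `v` collapse by
  -- `sum-δ`.
  hit : Fin n → Fin n → Fin n × Fin n → ℕ
  hit u v (a , c) = δ v c * δ u a + δ v a * δ u c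

  adj⇒hit : ∀ {G u v} → Adj G u v → 1 ≤ ∑ₗ (hit u v) G
  adj⇒hit {G} {u} {v} (inj₁ m) = ≤-trans
    (≤-trans (≤-reflexive (sym (cong₂ _*_ (δ-refl v) (δ-refl u)))) (m≤m+n _ _)) (∑ₗ-∈ (hit u v) m)
  adj⇒hit {G} {u} {v} (inj₂ m) = ≤-trans
    (≤-trans (≤-reflexive (sym (cong₂ _*_ (δ-refl v) (δ-refl u)))) (m≤n+m _ (δ v u * δ u v))) (∑ₗ-∈ (hit u v) m)

  sum-hits : ∀ (G : Graph n) u → sum (λ v → ∑ₗ (hit u v) G) ≡ deg G u
  sum-hits G u = trans (sum-∑ₗ-comm (hit u) G) (∑ₗ-cong (λ where
    (a , c) → trans (∑-distrib-+ (λ v → δ v c * δ u a) (λ v → δ v a * δ u c))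
      (cong₂ _+_ (sum-δ (λ _ → δ u a) c) (sum-δ (λ _ → δ u c) a))) G)

  sum-adj≤deg : ∀ (G : Graph n) v → sum (λ x → 𝟙 (adj? G v x)) ≤ deg G v
  sum-adj≤deg G v = begin
    sum (λ x → 𝟙 (adj? G v x))                  ≤⟨ sum-mono-≤ (λ x → 𝟙≤ (adj? G v x) adj⇒hit) ⟩
    sum (λ x → ∑ₗ (hit v x) G)                  ≡⟨ sum-hits G v ⟩
    deg G v                                     ∎
    where open ≤-Reasoning

  starColouring : ∀ (G : Graph n) v → Colouring
  starColouring G v x with x ≟ᶠ v | adj? G v x
  ... | yes _ | _     = just true
  ... | no _  | yes _ = nothing
  ... | no _  | no _  = just false

  -- Otherwise the neighbourhood of v would be a cut of fewer than k vertices.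
  kConnected⇒k≤deg : ∀ {k G} → KConnected k G → ∀ v → k ≤ deg G v
  kConnected⇒k≤deg {k} {G} conn v with k ℕ.≤? deg G v
  ... | yes k≤d = k≤d
  ... | no k≰d = ⊥-elim (separated⇒¬KConnected sep ((v , col-v) , other) conn)
    where
    open ≤-Reasoning
    col = starColouring G v

    col-v : col v ≡ just true
    col-v with v ≟ᶠ v | adj? G v v
    ... | yes _ | _ = refl
    ... | no v≢v | _ = ⊥-elim (v≢v refl)

    nothing⇒adj : ∀ x → col x ≡ nothing → Adj G v x
    nothing⇒adj x p with x ≟ᶠ v | adj? G v x
    ... | no _ | yes a = a

    true⇒≡v : ∀ x → col x ≡ just true → x ≡ v
    true⇒≡v x p with x ≟ᶠ v | adj? G v x
    ... | yes x≡v | _ = x≡v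
    ... | no _ | yes _ = case p of λ ()
    ... | no _ | no _ = case p of λ ()

    false⇒¬adj : ∀ x → col x ≡ just false → ¬ Adj G v x
    false⇒¬adj x p with x ≟ᶠ v | adj? G v x
    ... | no _ | no ¬a = ¬a

    cut≤deg : size col nothing ≤ deg G v
    cut≤deg = ≤-trans
      (sum-mono-≤ λ x → 𝟙-mono (col x ≟ᶜ nothing) (adj? G v x) (nothing⇒adj x)) (sum-adj≤deg G v)

    consistent : ∀ {x y a b} → Adj G x y → col x ≡ just a → col y ≡ just b → a ≡ b
    consistent {a = true} {true} _ _ _ = refl
    consistent {a = false} {false} _ _ _ = refl
    consistent {x} {y} {true} {false} a p q =
      ⊥-elim (false⇒¬adj y q (subst (λ z → Adj G z y) (true⇒≡v x p) a))
    consistent {x} {y} {false} {true} a p q =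
      ⊥-elim (false⇒¬adj x p (subst (λ z → Adj G z x) (true⇒≡v y q) (adj-sym a)))

    sep : Separates k G col
    sep = record
      { cut<k = ≤-<-trans cut≤deg (≰⇒> k≰d)
      ; uncrossed = consistent
      }

    -- If the side `false` were empty, every vertex would be `v` or a cut vertex, giving
    -- `n ≤ 1 + deg G v ≤ k`.
    other : ∃ λ x → col x ≡ just false
    other with any? (λ x → col x ≟ᶜ just false)
    ... | yes found = found
    ... | no none = ⊥-elim (<⇒≱ (proj₁ conn) (begin
      n                                           ≡⟨ *-identityʳ n ⟨
      n * 1                                       ≡⟨ sum-const n 1 ⟨
      sum {n} (λ _ → 1)                           ≤⟨ sum-mono-≤ covered ⟩
      sum (λ x → δ x v * 1 + class col nothing x) ≡⟨ ∑-distrib-+ (λ x → δ x v * 1) (class col nothing) ⟩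
      sum (λ x → δ x v * 1) + size col nothing    ≡⟨ cong (_+ size col nothing) (sum-δ (λ _ → 1) v) ⟩
      suc (size col nothing)                      ≤⟨ ≤-<-trans cut≤deg (≰⇒> k≰d) ⟩
      k                                           ∎))
      where
      covered : ∀ x → 1 ≤ δ x v * 1 + class col nothing x
      covered x = case-colour (col x) refl
        where
        case-colour : ∀ c → col x ≡ c → 1 ≤ δ x v * 1 + class col nothing x
        case-colour nothing eq = ≤-trans (≤-reflexive (sym (𝟙-yes (col x ≟ᶜ nothing) eq))) (m≤n+m _ (δ x v * 1))
        case-colour (just true) eq = ≤-trans
          (≤-reflexive (sym (trans (*-identityʳ (δ x v)) (𝟙-yes (x ≟ᶠ v) (true⇒≡v x eq))))) (m≤m+n _ _)
        case-colour (just false) eq = ⊥-elim (none (x , eq))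

  -- Weighted handshake: each end of an edge carries the weight of its vertex. With `w` the
  -- indicator of a side, this bounds the size of that side.
  degree-sum : ∀ {k G} → KConnected k G → (w : Fin n → ℕ) → k * sum w ≤ ∑ₗ (endpoints w) G
  degree-sum {k} {G} conn w = begin
    k * sum w                                             ≡⟨ *-distribˡ-sum k w ⟩
    sum (λ v → k * w v)                                   ≤⟨ sum-mono-≤ (λ v → *-monoˡ-≤ (w v) (k≤deg v)) ⟩
    sum (λ v → deg G v * w v)                             ≡⟨ sum-cong-≗ (λ v → ∑ₗ-*ʳ (endpoints (δ v)) (w v) G) ⟩
    sum (λ v → ∑ₗ (λ e → endpoints (δ v) e * w v) G)      ≡⟨ sum-∑ₗ-comm (λ v e → endpoints (δ v) e * w v) G ⟩
    ∑ₗ (λ e → sum (λ v → endpoints (δ v) e * w v)) G      ≡⟨ ∑ₗ-cong sum-ends G ⟩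
    ∑ₗ (endpoints w) G                                    ∎
    where
    open ≤-Reasoning
    k≤deg = kConnected⇒k≤deg conn

    sum-ends : ∀ e → sum (λ v → endpoints (δ v) e * w v) ≡ endpoints w e
    sum-ends (a , b) = trans (sum-cong-≗ λ v → *-distribʳ-+ (w v) (δ v a) (δ v b))
      (trans (∑-distrib-+ (λ v → δ v a * w v) (λ v → δ v b * w v)) (cong₂ _+_ (sum-δ w a) (sum-δ w b)))

  few-edges⇒¬KConnected : ∀ {k G} → length G * 2 < k * n → ¬ KConnected k G
  few-edges⇒¬KConnected {k} {G} few conn = <⇒≱ few (begin
    k * n                     ≡⟨ cong (k *_) (trans (sum-const n 1) (*-identityʳ n)) ⟨
    k * sum {n} (λ _ → 1)     ≤⟨ degree-sum conn (λ _ → 1) ⟩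
    ∑ₗ (endpoints (λ _ → 1)) G ≤⟨ ∑ₗ-≤-length (λ _ → ≤-refl) G ⟩
    length G * 2              ∎)
    where open ≤-Reasoning

  -- In a saturated graph only pairs meeting both sides of the separation are
  -- missing; all of them meet the colour class b.
  saturated-edges : ∀ {k G col} b → Saturated k G → Separates k G col → Nontrivial col →
    n C 2 ≤ length G + size col (just b) * n
  -- Ordered pairs are counted: each is on the diagonal, has a coordinate in the side `b`, or is an
  -- edge of `G`. Doubling and adding `n` brings `n C 2` into this form.
  saturated-edges {k} {G} {col} b sat sep nt = *-cancelˡ-≤ 2 (+-cancelʳ-≤ n _ _ (begin
    2 * (n C 2) + n                                 ≡⟨ 2*nC2 n ⟩
    n * n                                           ≡⟨ cong (n *_) (*-identityʳ n) ⟨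
    n * (n * 1)                                     ≡⟨ trans (sum-cong-≗ {n} (λ _ → sum-const n 1)) (sum-const n (n * 1)) ⟨
    sum {n} (λ u → sum {n} (λ v → 1))               ≤⟨ sum-mono-≤ (λ u → sum-mono-≤ (λ v → covered u v)) ⟩
    sum (λ u → sum (λ v → (δ v u * 1 + (β u + β v)) + ∑ₗ (hit u v) G))
      ≡⟨ sum-cong-≗ row ⟩
    sum (λ u → (1 + (n * β u + size col (just b))) + ∑ₗ (endpoints (δ u)) G)
      ≡⟨ ∑-distrib-+ (λ u → 1 + (n * β u + size col (just b))) (deg G) ⟩
    sum (λ u → 1 + (n * β u + size col (just b))) + sum (deg G)
      ≡⟨ cong₂ _+_ total-β total-deg ⟩
    n + (n * size col (just b) + n * size col (just b)) + length G * 2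
      ≡⟨ regroup n (size col (just b)) (length G) ⟩
    2 * (length G + size col (just b) * n) + n      ∎))
    where
    open ≤-Reasoning
    β = class col (just b)

    regroup : ∀ n s g → n + (n * s + n * s) + g * 2 ≡ 2 * (g + s * n) + n
    regroup = solve-∀

    row : ∀ u → sum (λ v → (δ v u * 1 + (β u + β v)) + ∑ₗ (hit u v) G)
              ≡ (1 + (n * β u + size col (just b))) + ∑ₗ (endpoints (δ u)) G
    row u = trans (∑-distrib-+ (λ v → δ v u * 1 + (β u + β v)) (λ v → ∑ₗ (hit u v) G))
      (cong₂ _+_
        (trans (∑-distrib-+ (λ v → δ v u * 1) (λ v → β u + β v))
          (cong₂ _+_ (sum-δ (λ _ → 1) u)
            (trans (∑-distrib-+ (λ _ → β u) β) (cong (_+ size col (just b)) (sum-const n (β u))))))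
        (sum-hits G u))

    total-β : sum (λ u → 1 + (n * β u + size col (just b))) ≡ n + (n * size col (just b) + n * size col (just b))
    total-β = trans (∑-distrib-+ (λ _ → 1) (λ u → n * β u + size col (just b)))
      (cong₂ _+_ (trans (sum-const n 1) (*-identityʳ n))
        (trans (∑-distrib-+ (λ u → n * β u) (λ _ → size col (just b)))
          (cong₂ _+_ (sym (*-distribˡ-sum n β)) (sum-const n (size col (just b))))))

    total-deg : sum (deg G) ≡ length G * 2
    total-deg = trans (sum-∑ₗ-comm (λ u e → endpoints (δ u) e) G) (∑ₗ-const two G)
      where
      one : ∀ a → sum (λ u → δ u a) ≡ 1
      one a = trans (sum-cong-≗ λ u → sym (*-identityʳ (δ u a))) (sum-δ (λ _ → 1) a)

      two : ∀ e → sum (λ u → endpoints (δ u) e) ≡ 2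
      two (a , c) = trans (∑-distrib-+ (λ u → δ u a) (λ u → δ u c)) (cong₂ _+_ (one a) (one c))

    other-side : ∀ {x y a c} → col x ≡ just a → col y ≡ just c → col x ≢ just b → col y ≢ just b → a ≡ c
    other-side p q x≢ y≢ = trans (¬-not λ a≡b → x≢ (trans p (cong just a≡b)))
      (sym (¬-not λ c≡b → y≢ (trans q (cong just c≡b))))

    adj-< : ∀ {u v} → u Fin.< v → col u ≢ just b → col v ≢ just b → Adj G u v
    adj-< {u} {v} u<v u≢ v≢ = decidable-stable (adj? G u v) λ ¬a → sat u v
      (u<v , ¬a , separated⇒¬KConnected (separates-∷ sep λ p q → other-side p q u≢ v≢) nt)

    covered : ∀ u v → 1 ≤ (δ v u * 1 + (β u + β v)) + ∑ₗ (hit u v) G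
    covered u v with col u ≟ᶜ just b
    ... | yes _ = ≤-trans (m≤n+m 1 (δ v u * 1)) (≤-trans (+-monoʳ-≤ (δ v u * 1) (m≤m+n 1 _)) (m≤m+n _ _))
    ... | no u≢ with col v ≟ᶜ just b
    ... | yes _ = ≤-trans (m≤n+m 1 (δ v u * 1)) (m≤m+n _ _)
    ... | no v≢ with <-cmp u v
    ... | tri< u<v _ _ = ≤-trans (adj⇒hit (adj-< u<v u≢ v≢)) (m≤n+m _ (δ v u * 1 + 0))
    ... | tri> _ _ v<u = ≤-trans (adj⇒hit (adj-sym (adj-< v<u v≢ u≢))) (m≤n+m _ (δ v u * 1 + 0))
    ... | tri≈ _ refl _ = ≤-trans (≤-reflexive (sym (cong (λ d → d * 1 + 0) (δ-refl u)))) (m≤m+n _ _)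

-- Max's strategy

length-cartesianProduct : ∀ {a b} {A : Set a} {B : Set b} (xs : List A) (ys : List B) →
  length (cartesianProduct xs ys) ≡ length xs * length ys
length-cartesianProduct [] ys = refl
length-cartesianProduct (x ∷ xs) ys = trans (length-++ (List.map (x ,_) ys))
  (cong₂ _+_ (length-map (x ,_) ys) (length-cartesianProduct xs ys))

-- Max first joins all hubs to all targets, and then attaches every other
-- vertex z to the k targets of its block; D bounds the number of vertices
-- served by a block.
record Layout (k q D n : ℕ) : Set where
  field
    hub       : Fin k → Fin n
    hub-inj   : ∀ {i i′} → hub i ≡ hub i′ → i ≡ i′
    target    : Fin q → Fin k → Fin n
    target-inj : ∀ {j i j′ i′} → target j i ≡ target j′ i′ → j ≡ j′ × i ≡ i′
    -- `Legal` only takes pairs with the smaller vertex first, so Max's edges need a known order: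
    -- hubs below targets, targets below the vertices attached to them.
    hub<target : ∀ i j i′ → hub i Fin.< target j i′
    block     : Fin n → Fin q
    block₀    : Fin q
    block-fibre : ∀ j → sum (λ z → δ j (block z)) ≤ D

  Special : Fin n → Set
  Special v = (∃ λ i → v ≡ hub i) ⊎ (∃ λ j → ∃ λ i → v ≡ target j i)

  field
    special-or-above : ∀ v → Special v ⊎ (∀ j i → target j i Fin.< v)

module Strategy {k₁ q D n : ℕ} (layout : Layout (suc k₁) q D n) (s : ℕ) where

  open Layout layout

  k : ℕ
  k = suc k₁

  Hubs : Graph n → Set
  Hubs G = ∀ i j i′ → Adj G (hub i) (target j i′)

  Core : Graph n → Fin n → Set
  Core G v = Special v ⊎ (∀ i → Adj G v (target (block v) i))

  Missing : Graph n → Fin n → Set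
  Missing G v = (∀ j i → target j i Fin.< v) × ∃ λ i → ¬ Adj G v (target (block v) i)

  core-or-missing : ∀ G v → Core G v ⊎ Missing G v
  core-or-missing G v with special-or-above v
  ... | inj₁ special = inj₁ (inj₁ special)
  ... | inj₂ above with any? (λ i → ¬? (adj? G v (target (block v) i)))
  ... | yes missing = inj₂ (above , missing)
  ... | no none = inj₁ (inj₂ λ i →
    decidable-stable (adj? G v (target (block v) i)) λ ¬a → none (i , ¬a))

  core-∷ : ∀ {G e v} → Core G v → Core (e ∷ G) v
  core-∷ = Sum.map₂ λ full i → adj-∷ (full i)

  Avoids : Graph n → Colouring → Bool → Set
  Avoids G col b = ∀ v → Core G v → col v ≢ just b

  avoids-tail : ∀ {G e col b} → Avoids (e ∷ G) col b → Avoids G col b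
  avoids-tail av v = av v ∘ core-∷

  -- Every separation is covered because the cut of the final graph is not known in advance. Extra
  -- edges only remove separations, so `Good` persists.
  Good : Graph n → Set
  Good G = ∀ {col} → Separates k G col → ∃ λ b → size col (just b) ≤ s

  good-∷ : ∀ {G e} → Good G → Good (e ∷ G)
  good-∷ good sep = good (separates-tail sep)

  module _ {G : Graph n} {col : Colouring} (sep : Separates k G col) where

    neighbour-colour : ∀ {u v c} → Adj G u v → col u ≡ just c → col v ≢ just (not c)
    neighbour-colour a p q = not-¬ refl (uncrossed sep a p q)

    uncut : (f : Fin k → Fin n) → (∀ {i j} → f i ≡ f j → i ≡ j) → ∃ λ i → ∃ λ c → col (f i) ≡ just c
    uncut f f-inj with any? (λ i → ¬? (col (f i) ≟ᶜ nothing))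
    ... | yes (i , coloured) with col (f i) in eq
    ...   | just c = i , c , eq
    ...   | nothing = ⊥-elim (coloured refl)
    uncut f f-inj | no none = ⊥-elim (<⇒≱ (cut<k sep) (begin
      k                                     ≡⟨ *-identityʳ k ⟨
      k * 1                                 ≡⟨ sum-const k 1 ⟨
      sum {k} (λ _ → 1)                     ≡⟨ sum-cong-≗ (λ i → 𝟙-yes (col (f i) ≟ᶜ nothing) (cut i)) ⟨
      sum (λ i → class col nothing (f i))   ≤⟨ sum-injection f (class col nothing) f-inj ⟩
      size col nothing                      ∎))
      where
      open ≤-Reasoning
      cut : ∀ i → col (f i) ≡ nothing
      cut i = decidable-stable (col (f i) ≟ᶜ nothing) λ ¬p → none (i , ¬p)

    -- Fewer than k deleted vertices leave a hub, and leave a target in every block.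
    core-one-sided : Hubs G → ∃ λ b → Avoids G col b
    core-one-sided hubs with uncut hub hub-inj
    ... | i , c , hub-c = not c , avoids
      where
      target≢ : ∀ j i′ → col (target j i′) ≢ just (not c)
      target≢ j i′ = neighbour-colour (hubs i j i′) hub-c

      via-block : ∀ {v} j → (∀ i′ → Adj G v (target j i′)) → col v ≢ just (not c)
      via-block j adj with uncut (target j) (proj₂ ∘ target-inj)
      ... | i′ , d , target-d = neighbour-colour (adj-sym (adj i′)) (trans target-d (cong just d≡c))
        where
        d≡c : d ≡ c
        d≡c = trans (¬-not λ d≡ → target≢ j i′ (trans target-d (cong just d≡))) (not-involutive c)

      avoids : Avoids G col (not c)
      avoids v (inj₁ (inj₁ (i′ , refl))) = via-block block₀ (hubs i′ block₀)
      avoids v (inj₁ (inj₂ (j , i′ , refl))) = target≢ j i′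
      avoids v (inj₂ full) = via-block (block v) full

    -- A neighbour of the side `b` lies in that side or in the cut; this lets one endpoint pay for a
    -- whole edge.
    neighbour-class : ∀ b {u v} → Adj G u v → class col (just b) v ≤ class col (just b) u + class col nothing u
    neighbour-class b {u} {v} a = 𝟙≤ (col v ≟ᶜ just b) λ p → by-colour p (col u) refl
      where
      by-colour : col v ≡ just b → ∀ c → col u ≡ c → 1 ≤ class col (just b) u + class col nothing u
      by-colour p nothing eq =
        ≤-trans (≤-reflexive (sym (𝟙-yes (col u ≟ᶜ nothing) eq))) (m≤n+m _ (class col (just b) u))
      by-colour p (just c) eq =
        ≤-trans (≤-reflexive (sym (𝟙-yes (col u ≟ᶜ just b) (trans eq (cong just (uncrossed sep a eq p)))))) (m≤m+n _ _)

  -- Some separation of `G` has two nonempty sides, one of which avoids the core; any vertex there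
  -- can still receive an answer.
  outside-core : ∀ {G} → k < n → ¬ KConnected k G → Hubs G → ∃ (Missing G)
  outside-core {G} k<n ¬conn hubs with connected-or-separated k<n G
  ... | inj₁ conn = ⊥-elim (¬conn conn)
  ... | inj₂ (col , sep , (u , pu) , (v , pv)) with core-one-sided sep hubs
  ... | true , avoids = u , Sum.[ (λ core → ⊥-elim (avoids u core pu)) , (λ m → m) ] (core-or-missing G u)
  ... | false , avoids = v , Sum.[ (λ core → ⊥-elim (avoids v core pv)) , (λ m → m) ] (core-or-missing G v)

  -- Charging the edges at a side to Max's answers.

  weight : Colouring → Bool → Graph n → ℕ
  weight col b = ∑ₗ (endpoints (class col (just b)))

  -- When Max answers an edge of Mini with an edge from z to a target, the two
  -- edges add at most 3 to weight if z is on the side b and at most 2 if z is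
  -- in the cut.
  credit : Colouring → Bool → Fin n → ℕ
  credit col b z = 3 * class col (just b) z + 2 * class col nothing z

  -- Read off from `G` alone and not from the play: every edge from `z` to its own block counts as
  -- an answer, whoever added it. So the invariants speak of the current graph only.
  credits : Colouring → Bool → Graph n → ℕ
  credits col b G = sum λ z → sum λ i → 𝟙 (adj? G z (target (block z) i)) * credit col b z

  credits-∷ : ∀ {G} e col b → credits col b G ≤ credits col b (e ∷ G)
  credits-∷ {G} e col b = sum-mono-≤ λ z → sum-mono-≤ λ i → *-monoˡ-≤ (credit col b z)
    (𝟙-mono (adj? G z (target (block z) i)) (adj? (e ∷ G) z (target (block z) i)) adj-∷)

  credits-answer : ∀ {G} col b z i → ¬ Adj G z (target (block z) i) →
    credits col b G + credit col b z ≤ credits col b ((target (block z) i , z) ∷ G)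
  credits-answer {G} col b z i ¬a =
    sum-mono-gap (λ z → sum-mono-≤ (mono z)) z (sum-mono-gap (mono z) i
      (≤-reflexive (trans
        (cong (λ x → x * c + c) (𝟙-no (adj? G z w) ¬a))
        (sym (trans (cong (_* c) (𝟙-yes (adj? G′ z w) (inj₂ (here refl)))) (*-identityˡ c))))))
    where
    w = target (block z) i
    G′ = (w , z) ∷ G
    c = credit col b z
    mono : ∀ z i → 𝟙 (adj? G z (target (block z) i)) * credit col b z
                 ≤ 𝟙 (adj? G′ z (target (block z) i)) * credit col b z
    mono z i = *-monoˡ-≤ (credit col b z)
      (𝟙-mono (adj? G z (target (block z) i)) (adj? G′ z (target (block z) i)) adj-∷)

  -- A vertex of the side b outside the core only sees targets inside the cut.
  credits≤ : ∀ {G col b} → Separates k G col → Avoids G col b →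
    credits col b G ≤ 3 * (D * size col nothing) + 2 * (k * size col nothing)
  credits≤ {G} {col} {b} sep av = begin
    credits col b G
      ≤⟨ sum-mono-≤ (λ z → sum-mono-≤ (λ i → pointwise z i)) ⟩
    sum (λ z → sum (λ i → 3 * S (target (block z) i) + 2 * S z))
      ≡⟨ sum-cong-≗ (λ z → trans (∑-distrib-+ (λ i → 3 * S (target (block z) i)) (λ _ → 2 * S z))
           (cong₂ _+_ (sym (*-distribˡ-sum 3 (λ i → S (target (block z) i)))) (sum-const k (2 * S z)))) ⟩
    sum (λ z → 3 * F (block z) + k * (2 * S z))
      ≡⟨ ∑-distrib-+ (λ z → 3 * F (block z)) (λ z → k * (2 * S z)) ⟩
    sum (λ z → 3 * F (block z)) + sum (λ z → k * (2 * S z))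
      ≡⟨ cong₂ _+_ (sym (*-distribˡ-sum 3 (F ∘ block)))
           (trans (sym (*-distribˡ-sum k (λ z → 2 * S z))) (cong (k *_) (sym (*-distribˡ-sum 2 S)))) ⟩
    3 * sum (F ∘ block) + k * (2 * sum S)
      -- A target is charged only by the at most `D` vertices that its block serves, and distinct
      -- indices give distinct targets.
      ≤⟨ +-mono-≤ (*-monoʳ-≤ 3 (≤-trans (sum-fibres D block F block-fibre)
                                         (*-monoʳ-≤ D (sum-injection₂ target S target-inj))))
                  (≤-reflexive (swap k (sum S))) ⟩
    3 * (D * size col nothing) + 2 * (k * size col nothing) ∎
    where
    open ≤-Reasoning
    S = class col nothing
    B = class col (just b)
    F : Fin q → ℕ
    F j = sum λ i → S (target j i)

    swap : ∀ k x → k * (2 * x) ≡ 2 * (k * x)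
    swap = solve-∀

    B≤S : ∀ z i → Adj G z (target (block z) i) → B z ≤ S (target (block z) i)
    B≤S z i a = ≤-trans (neighbour-class sep b (adj-sym a))
      (≤-reflexive (cong (_+ S (target (block z) i))
        (𝟙-no (col _ ≟ᶜ just b) (av _ (inj₁ (inj₂ (_ , _ , refl)))))))

    pointwise : ∀ z i → 𝟙 (adj? G z (target (block z) i)) * credit col b z
                      ≤ 3 * S (target (block z) i) + 2 * S z
    pointwise z i = 𝟙*≤ (adj? G z (target (block z) i)) λ a →
      +-monoˡ-≤ (2 * S z) (*-monoʳ-≤ 3 (B≤S z i a))

  wishes : List (Fin k × Fin q × Fin k)
  wishes = cartesianProduct (allFin k) (cartesianProduct (allFin q) (allFin k))

  length-wishes : length wishes ≡ k * (q * k)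
  length-wishes = trans (length-cartesianProduct (allFin k) (cartesianProduct (allFin q) (allFin k)))
    (cong₂ _*_ {x = length (allFin k)} {k} (length-tabulate (λ i → i))
      (trans (length-cartesianProduct (allFin q) (allFin k))
        (cong₂ _*_ {x = length (allFin q)} {q} {length (allFin k)} {k}
          (length-tabulate (λ i → i)) (length-tabulate (λ i → i)))))

  -- Each hub-target edge costs one move of Max and one of Mini; if Mini starts, the building phase
  -- can reach `suc N` edges.
  N : ℕ
  N = 2 * (k * (q * k))

  -- Invariant before Mini's moves: `suc N * 2` pays for both ends of the edges of the building
  -- phase, `credits` for all later edges.
  Bounded : Graph n → Set
  Bounded G = ∀ {col b} → Separates k G col → Avoids G col b →
    weight col b G ≤ suc N * 2 + credits col b G

  -- Invariant before Max's moves: the last term is the debt left by Mini's latest edge, charged to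
  -- the vertex `z` where Max answers.
  BoundedUpTo : Fin n → Graph n → Set
  BoundedUpTo z G = ∀ {col b} → Separates k G col → Avoids G col b →
    weight col b G ≤ suc N * 2 + credits col b G + 2 * (class col (just b) z + class col nothing z)

  few-edges-bounded : ∀ {z G} → length G ≤ suc N → BoundedUpTo z G
  few-edges-bounded {z} {G} few {col} {b} _ _ = ≤-trans
    (∑ₗ-≤-length (λ { (u , v) → +-mono-≤ (𝟙≤1 (col u ≟ᶜ just b)) (𝟙≤1 (col v ≟ᶜ just b)) }) G)
    (≤-trans (*-monoˡ-≤ 2 few) (≤-trans (m≤m+n _ (credits col b G)) (m≤m+n _ _)))

  bounded-relax : ∀ {G} z → Bounded G → BoundedUpTo z G
  bounded-relax z bound sep av = ≤-trans (bound sep av) (m≤m+n _ _)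

  -- The target lies in the core and adds nothing to `weight`, so Max's edge and the debt at `z`
  -- together amount to `credit col b z`.
  bounded-answer : ∀ {G} z i → ¬ Adj G z (target (block z) i) →
    BoundedUpTo z G → Bounded ((target (block z) i , z) ∷ G)
  bounded-answer {G} z i ¬a bound {col} {b} sep av = begin
    (B w + B z) + weight col b G
      ≡⟨ cong (λ x → (x + B z) + weight col b G)
              (𝟙-no (col w ≟ᶜ just b) (av w (inj₁ (inj₂ (_ , _ , refl))))) ⟩
    B z + weight col b G
      ≤⟨ +-monoʳ-≤ (B z) (bound (separates-tail sep) (avoids-tail av)) ⟩
    B z + (suc N * 2 + credits col b G + 2 * (B z + S z))
      ≡⟨ regroup (B z) (S z) (suc N * 2) (credits col b G) ⟩
    suc N * 2 + (credits col b G + credit col b z)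
      ≤⟨ +-monoʳ-≤ (suc N * 2) (credits-answer col b z i ¬a) ⟩
    suc N * 2 + credits col b ((w , z) ∷ G) ∎
    where
    open ≤-Reasoning
    w = target (block z) i
    B = class col (just b)
    S = class col nothing
    regroup : ∀ x y c f → x + (c + f + 2 * (x + y)) ≡ c + (f + (3 * x + 2 * y))
    regroup = solve-∀

  module _ {G : Graph n} {u v : Fin n} (bound : Bounded G) where

    private
      G′ = (u , v) ∷ G

    bounded-by : ∀ z → (∀ {col b} → Separates k G′ col → Avoids G′ col b →
      class col (just b) u + class col (just b) v ≤ 2 * (class col (just b) z + class col nothing z)) →
      BoundedUpTo z G′
    bounded-by z le {col} {b} sep av = ≤-trans
      (≤-reflexive (+-comm (class col (just b) u + class col (just b) v) (weight col b G)))
      (+-mono-≤ (≤-trans (bound (separates-tail sep) (avoids-tail av))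
                         (+-monoʳ-≤ (suc N * 2) (credits-∷ {G} (u , v) col b)))
                (le sep av))

    -- Max replies at an endpoint of Mini's edge that is not yet in the core;
    -- if there is none, the edge does not meet the side avoiding the core.
    choose-reply : k < n → ¬ KConnected k G′ → Hubs G′ → ∃ λ z → Missing G′ z × BoundedUpTo z G′
    choose-reply k<n ¬conn hubs with core-or-missing G′ u | core-or-missing G′ v
    -- The other endpoint is on the side `b` only if `u` is there or in the cut, so each endpoint
    -- counts at most `t`.
    ... | inj₂ missing | _ = u , missing , bounded-by u λ {col} {b} sep av →
      let t = class col (just b) u + class col nothing u in ≤-trans
      (+-mono-≤ (m≤m+n (class col (just b) u) (class col nothing u)) (neighbour-class sep b (inj₁ (here refl))))
      (≤-reflexive (cong (t +_) (sym (+-identityʳ t))))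
    ... | inj₁ _ | inj₂ missing = v , missing , bounded-by v λ {col} {b} sep av →
      let t = class col (just b) v + class col nothing v in ≤-trans
      (+-mono-≤ (neighbour-class sep b (inj₂ (here refl))) (m≤m+n (class col (just b) v) (class col nothing v)))
      (≤-reflexive (cong (t +_) (sym (+-identityʳ t))))
    ... | inj₁ core-u | inj₁ core-v with outside-core k<n ¬conn hubs
    ... | z , missing = z , missing , bounded-by z λ {col} {b} sep av → ≤-trans
      (≤-reflexive (cong₂ _+_ (𝟙-no (col u ≟ᶜ just b) (av u core-u)) (𝟙-no (col v ≟ᶜ just b) (av v core-v)))) z≤n

  -- `few` excludes k-connectivity during the building phase. The terms of `slack` are the two ends
  -- of the blocking edge, the building phase, the bound of `credits≤` for a cut of at most `k₁`
  -- vertices, and the debt at `z`.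
  module Game
    (k<n   : k < n)
    (few   : (2 + N) * 2 < k * n)
    (slack : 2 + (suc N * 2 + (3 * (D * k₁) + 2 * (k * k₁)) + 4) ≤ k * s)
    where

    goal : ℕ
    goal = n C 2 ∸ s * n

    -- In the k-connected graph e ∷ G every vertex of the side b has degree at
    -- least k, and these degrees are paid for by weight.
    blocked⇒good : ∀ {G z e} → Hubs G → BoundedUpTo z G → KConnected k (e ∷ G) → Good G
    blocked⇒good {G} {z} {e@(u , v)} hubs bound conn {col} sep with core-one-sided sep hubs
    ... | b , av = b , *-cancelˡ-≤ k (begin
      k * size col (just b)
        ≤⟨ degree-sum conn B ⟩
      (B u + B v) + weight col b G
        ≤⟨ +-mono-≤ (+-mono-≤ (B≤1 u) (B≤1 v)) (bound sep av) ⟩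
      2 + (suc N * 2 + credits col b G + 2 * (B z + S z))
        ≤⟨ +-monoʳ-≤ 2 (+-mono-≤ (+-monoʳ-≤ (suc N * 2) (≤-trans (credits≤ sep av)
             (+-mono-≤ (*-monoʳ-≤ 3 (*-monoʳ-≤ D cut≤k₁)) (*-monoʳ-≤ 2 (*-monoʳ-≤ k cut≤k₁)))))
             (*-monoʳ-≤ 2 (+-mono-≤ (B≤1 z) (𝟙≤1 (col z ≟ᶜ nothing))))) ⟩
      2 + (suc N * 2 + (3 * (D * k₁) + 2 * (k * k₁)) + 4)
        ≤⟨ slack ⟩
      k * s ∎)
      where
      open ≤-Reasoning
      B = class col (just b)
      S = class col nothing
      B≤1 : ∀ x → B x ≤ 1
      B≤1 x = 𝟙≤1 (col x ≟ᶜ just b)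
      cut≤k₁ : size col nothing ≤ k₁
      cut≤k₁ = s≤s⁻¹ (cut<k sep)

    saturated⇒goal : ∀ {G} → ¬ KConnected k G → Good G → Saturated k G → goal ≤ length G
    saturated⇒goal {G} ¬conn good sat with connected-or-separated k<n G
    ... | inj₁ conn = ⊥-elim (¬conn conn)
    ... | inj₂ (col , sep , nt) with good sep
    ... | b , small = m≤n+o⇒m∸n≤o (n C 2) (s * n) (≤-trans (saturated-edges b sat sep nt)
      (≤-trans (+-monoʳ-≤ (length G) (*-monoˡ-≤ n small)) (≤-reflexive (+-comm (length G) _))))

    -- The graph is not complete, and a missing edge can only be illegal by making it k-connected.
    -- So saturation also leads to `blocked⇒good`.
    saturated⇒blocked : ∀ {G} → ¬ KConnected k G → Saturated k G → ∃ λ e → KConnected k (e ∷ G)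
    saturated⇒blocked {G} ¬conn sat with missing-edge k<n ¬conn
    ... | u , v , u<v , ¬a = (u , v) ,
      decidable-stable (kConnected? k ((u , v) ∷ G)) λ ¬c → sat u v (u<v , ¬a , ¬c)

    few⇒¬conn : ∀ {G} → length G ≤ 2 + N → ¬ KConnected k G
    few⇒¬conn le = few-edges⇒¬KConnected (≤-<-trans (*-monoˡ-≤ 2 le) few)

    -- The three phases of the game, the last one first.

    after : ∀ {f} {G : Graph n} {u v} → freePairs G < suc f → Legal k G u v → freePairs ((u , v) ∷ G) < f
    after {f} {G} lt legal = <-≤-trans (legal⇒freePairs-< legal) (s≤s⁻¹ lt)

    -- `Good` persists, so any legal edge will do. The fuel `f` exceeds the number of free pairs and
    -- makes the recursion structural.
    finish-max : ∀ f {G} → freePairs G < f → ¬ KConnected k G → Good G → MaxForces k n Max G goal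
    finish-mini : ∀ f {G} → freePairs G < f → ¬ KConnected k G → Good G → MaxForces k n Mini G goal

    finish-max (suc f) {G} lt ¬conn good with any? (λ u → any? (λ v → legal? k G u v))
    ... | yes (u , v , legal) =
      maxMove u v legal (finish-mini f (after {f} {G} lt legal) (proj₂ (proj₂ legal)) (good-∷ good))
    ... | no none = maxEnd sat (saturated⇒goal ¬conn good sat)
      where
      sat : Saturated k G
      sat u v legal = none (u , v , legal)

    finish-mini (suc f) {G} lt ¬conn good = miniTurn (saturated⇒goal ¬conn good) λ u v legal →
      finish-max f (after {f} {G} lt legal) (proj₂ (proj₂ legal)) (good-∷ good)

    attach-max : ∀ f {G z} → freePairs G < f → ¬ KConnected k G → Hubs G →
      Missing G z → BoundedUpTo z G → MaxForces k n Max G goal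
    attach-mini : ∀ f {G} → freePairs G < f → ¬ KConnected k G → Hubs G →
      Bounded G → MaxForces k n Mini G goal

    attach-max f@(suc f′) {G} {z} lt ¬conn hubs (above , i , ¬a) bound
      with kConnected? k ((target (block z) i , z) ∷ G)
    -- An illegal answer ends the phase: the graph is one edge short of k-connectivity, so every cut
    -- already has a small side.
    ... | yes conn = finish-max f lt ¬conn (blocked⇒good hubs bound conn)
    ... | no ¬conn′ = maxMove _ _ legal (attach-mini f′ (after {f′} {G} lt legal) ¬conn′
      (λ i j i′ → adj-∷ (hubs i j i′)) (bounded-answer z i ¬a bound))
      where
      legal : Legal k G (target (block z) i) z
      legal = above _ _ , ¬a ∘ adj-sym , ¬conn′

    attach-mini (suc f) {G} lt ¬conn hubs bound = miniTurn
      (λ sat → saturated⇒goal ¬conn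
        -- `hub zero` is an arbitrary vertex: at Mini's turn there is no debt to charge to it.
        (blocked⇒good hubs (bounded-relax (hub zero) bound) (proj₂ (saturated⇒blocked ¬conn sat))) sat)
      λ u v legal → move legal (λ i j i′ → adj-∷ (hubs i j i′))
      where
      move : ∀ {u v} → Legal k G u v → Hubs ((u , v) ∷ G) → MaxForces k n Max ((u , v) ∷ G) goal
      move legal hubs′ with choose-reply bound k<n (proj₂ (proj₂ legal)) hubs′
      ... | z , missing , bound′ =
        attach-max f (after {f} {G} lt legal) (proj₂ (proj₂ legal)) hubs′ missing bound′

    Pending : Graph n → List (Fin k × Fin q × Fin k) → Set
    Pending G L = ∀ i j i′ → Adj G (hub i) (target j i′) ⊎ (i , j , i′) ∈ L

    pending-∷ : ∀ {G e L} → Pending G L → Pending (e ∷ G) L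
    pending-∷ pend i j i′ = Sum.map₁ adj-∷ (pend i j i′)

    pending-done : ∀ {G i j i′ L} → Adj G (hub i) (target j i′) → Pending G ((i , j , i′) ∷ L) → Pending G L
    pending-done a pend i j i′ with pend i j i′
    ... | inj₁ b = inj₁ b
    ... | inj₂ (here refl) = inj₁ a
    ... | inj₂ (there m) = inj₂ m

    -- Each pending edge reserves two units of the edge budget, one per player; an edge already
    -- present is dropped without using a move.
    build-max : ∀ f {G} L → freePairs G < f → Pending G L →
      length G + 2 * length L ≤ suc N → MaxForces k n Max G goal
    build-mini : ∀ f {G} L → freePairs G < f → Pending G L →
      length G + 2 * length L ≤ N → MaxForces k n Mini G goal

    build-max f {G} [] lt pend le = go (outside-core k<n ¬conn hubs)
      where
      len : length G ≤ suc N
      len = ≤-trans (m≤m+n (length G) 0) le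
      ¬conn : ¬ KConnected k G
      ¬conn = few⇒¬conn (m≤n⇒m≤1+n len)
      hubs : Hubs G
      hubs i j i′ with pend i j i′
      ... | inj₁ a = a
      go : ∃ (Missing G) → MaxForces k n Max G goal
      go (z , missing) = attach-max f lt ¬conn hubs missing (few-edges-bounded len)
    build-max f@(suc f′) {G} ((i , j , i′) ∷ L) lt pend le with adj? G (hub i) (target j i′)
    ... | yes a = build-max f L lt (pending-done a pend)
      (≤-trans (+-monoʳ-≤ (length G) (*-monoʳ-≤ 2 (n≤1+n (length L)))) le)
    ... | no ¬a = maxMove _ _ legal (build-mini f′ L (after {f′} {G} lt legal)
      (pending-done (inj₁ (here refl)) (pending-∷ pend)) len)
      where
      shift : ∀ g l → suc (suc g + 2 * l) ≡ g + 2 * suc l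
      shift = solve-∀
      len : suc (length G) + 2 * length L ≤ N
      len = s≤s⁻¹ (≤-trans (≤-reflexive (shift (length G) (length L))) le)
      legal : Legal k G (hub i) (target j i′)
      legal = hub<target i j i′ , ¬a , few⇒¬conn (≤-trans (m≤m+n _ _) (≤-trans len (m≤n+m N 2)))

    build-mini (suc f) {G} L lt pend le = miniTurn
      -- Saturation would leave the graph one edge short of k-connectivity, which takes more edges
      -- than have been played.
      (λ sat → ⊥-elim (few⇒¬conn {_ ∷ G} (s≤s (m≤n⇒m≤1+n len))
        (proj₂ (saturated⇒blocked (few⇒¬conn {G} (m≤n⇒m≤1+n (m≤n⇒m≤1+n len))) sat))))
      λ u v legal → build-max f L (after {f} {G} lt legal) (pending-∷ pend) (s≤s le)
      where
      len : length G ≤ N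
      len = ≤-trans (m≤m+n _ _) le

    max-forces-goal : ∀ first → MaxForces k n first [] goal
    max-forces-goal = λ where
        Mini → build-mini _ wishes ≤-refl all-pending (≤-reflexive (cong (2 *_) length-wishes))
        Max → build-max _ wishes ≤-refl all-pending (m≤n⇒m≤1+n (≤-reflexive (cong (2 *_) length-wishes)))
      where
      all-pending : Pending [] wishes
      all-pending i j i′ = inj₂ (∈-cartesianProduct⁺ (∈-allFin i) (∈-cartesianProduct⁺ (∈-allFin j) (∈-allFin i′)))

-- Choice of the parameters

module _ {k q D n : ℕ} (fits : k + q * k ≤ n) (covers : n ≤ D * q) where

  private
    hub : Fin k → Fin n
    hub i = Fin.inject≤ (i Fin.↑ˡ (q * k)) fits

    target : Fin q → Fin k → Fin n
    target j i = Fin.inject≤ (k Fin.↑ʳ Fin.combine j i) fits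

    toℕ-target : ∀ j i → toℕ (target j i) ≡ k + toℕ (Fin.combine j i)
    toℕ-target j i = trans (toℕ-inject≤ _ fits) (toℕ-↑ʳ k (Fin.combine j i))

    -- The residue of `z` modulo `q`. By `covers` the vertices fit into `D` rows of length `q`, so
    -- each residue occurs at most `D` times.
    block : Fin n → Fin q
    block z = proj₂ (Fin.remQuot {D} q (Fin.inject≤ z covers))

    block-fibre : ∀ j → sum (λ z → δ j (block z)) ≤ D
    block-fibre j = begin
      sum (λ z → δ j (block z))
        ≤⟨ sum-injection (λ z → Fin.inject≤ z covers) (λ x → δ j (proj₂ (Fin.remQuot {D} q x)))
             (λ {x} {y} → inject≤-injective covers covers x y) ⟩
      sum (λ x → δ j (proj₂ (Fin.remQuot {D} q x)))
        ≡⟨ sum-combine D (λ x → δ j (proj₂ (Fin.remQuot {D} q x))) ⟩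
      sum (λ d → sum (λ j′ → δ j (proj₂ (Fin.remQuot {D} q (Fin.combine {D} {q} d j′)))))
        ≡⟨ sum-cong-≗ (λ d → sum-cong-≗ (λ j′ → cong (δ j ∘ proj₂) (remQuot-combine {D} {q} d j′))) ⟩
      sum {D} (λ d → sum (λ j′ → δ j j′))
        ≤⟨ sum-mono-≤ {D} (λ d → sum-𝟙≤1 (j ≟ᶠ_) (λ p p′ → trans (sym p) p′)) ⟩
      sum {D} (λ d → 1)
        ≡⟨ trans (sum-const D 1) (*-identityʳ D) ⟩
      D ∎
      where open ≤-Reasoning

  -- The hubs are the vertices below k, the targets those of [k, k + q k).
  layout : Fin q → Layout k q D n
  layout j₀ = record
    { hub = hub
    ; hub-inj = λ {i} {i′} eq → ↑ˡ-injective (q * k) i i′ (inject≤-injective fits fits _ _ eq)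
    ; target = target
    ; target-inj = λ {j} {i} {j′} {i′} eq →
        combine-injective j i j′ i′ (↑ʳ-injective k _ _ (inject≤-injective fits fits _ _ eq))
    ; hub<target = λ i j i′ → subst₂ _<_
        (sym (trans (toℕ-inject≤ _ fits) (toℕ-↑ˡ i (q * k)))) (sym (toℕ-target j i′))
        (<-≤-trans (toℕ<n i) (m≤m+n k _))
    ; block = block
    ; block₀ = j₀
    ; block-fibre = block-fibre
    ; special-or-above = special-or-above
    }
    where
    special-or-above : ∀ v → ((∃ λ i → v ≡ hub i) ⊎ (∃ λ j → ∃ λ i → v ≡ target j i))
                           ⊎ (∀ j i → target j i Fin.< v)
    special-or-above v with toℕ v ℕ.<? k + q * k
    ... | no v≮ = inj₂ λ j i → <-≤-trans
      (subst (_< k + q * k) (sym (toℕ-target j i)) (+-monoʳ-< k (toℕ<n (Fin.combine j i)))) (≮⇒≥ v≮)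
    ... | yes v< = inj₁ (by-part (Fin.splitAt k x) refl)
      where
      x = Fin.fromℕ< v<
      v≡ : v ≡ Fin.inject≤ x fits
      v≡ = toℕ-injective (sym (trans (toℕ-inject≤ x fits) (toℕ-fromℕ< v<)))
      by-part : ∀ p → Fin.splitAt k x ≡ p → (∃ λ i → v ≡ hub i) ⊎ (∃ λ j → ∃ λ i → v ≡ target j i)
      by-part (inj₁ i) eq = inj₁ (i , trans v≡ (cong (λ x → Fin.inject≤ x fits) (sym (splitAt⁻¹-↑ˡ eq))))
      by-part (inj₂ y) eq = inj₂ (_ , _ , trans v≡ (cong (λ x → Fin.inject≤ x fits)
        (trans (sym (splitAt⁻¹-↑ʳ eq)) (cong (k Fin.↑ʳ_) (sym (combine-remQuot {q} k y))))))

-- `q` is the integer part of `√n / 2`; from `n` to `suc n` it grows by at most one.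
half-sqrt : ∀ n → ∃ λ q → 4 * (q * q) ≤ n × n < 4 * (suc q * suc q)
half-sqrt zero = 0 , z≤n , s≤s z≤n
half-sqrt (suc n) with half-sqrt n
... | q , lower , upper with suc n ℕ.<? 4 * (suc q * suc q)
... | yes n< = q , m≤n⇒m≤1+n lower , n<
... | no n≮ = suc q , ≮⇒≥ n≮ , ≤-<-trans upper
  (*-monoʳ-< 4 (*-mono-< (n<1+n (suc q)) (n<1+n (suc q))))

module Parameters {k₁ q n : ℕ} (lower : 4 * (q * q) ≤ n) (upper : n < 4 * (suc q * suc q))
  (large : suc k₁ + 18 ≤ q) where

  private
    k = suc k₁
    open ≤-Reasoning
    r = q ∸ (k + 18)
    q≡ : q ≡ k + 18 + r
    q≡ = sym (m+[n∸m]≡n large)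

  fits : k + q * k ≤ n
  fits = begin
    k + q * k           ≤⟨ +-mono-≤ k≤q² (*-monoʳ-≤ q k≤q) ⟩
    q * q + q * q       ≤⟨ m≤m+n _ (2 * (q * q)) ⟩
    q * q + q * q + 2 * (q * q) ≡⟨ four (q * q) ⟩
    4 * (q * q)         ≤⟨ lower ⟩
    n ∎
    where
    k≤q : k ≤ q
    k≤q = ≤-trans (m≤m+n k 18) large
    k≤q² : k ≤ q * q
    k≤q² = ≤-trans (m≤m*n k k) (*-mono-≤ k≤q k≤q)
    four : ∀ x → x + x + 2 * x ≡ 4 * x
    four = solve-∀

  covers : n ≤ (4 * q + 9) * q
  covers = s≤s⁻¹ (begin
    suc n                         ≤⟨ upper ⟩
    4 * (suc q * suc q)           ≡⟨ expand q ⟩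
    -- Absorbing the constant 4 into one more `q` is where the 9 in `4 * q + 9` comes from.
    4 * (q * q) + 8 * q + 4       ≤⟨ +-monoʳ-≤ (4 * (q * q) + 8 * q) (≤-trans 4≤18 (≤-trans (m≤n+m 18 k) large)) ⟩
    4 * (q * q) + 8 * q + q       ≡⟨ collect q ⟩
    (4 * q + 9) * q               ≤⟨ n≤1+n _ ⟩
    suc ((4 * q + 9) * q)         ∎)
    where
    4≤18 : 4 ≤ 18
    4≤18 = m≤m+n 4 14
    expand : ∀ q → 4 * (suc q * suc q) ≡ 4 * (q * q) + 8 * q + 4
    expand = solve-∀
    collect : ∀ q → 4 * (q * q) + 8 * q + q ≡ (4 * q + 9) * q
    collect = solve-∀

  k<n : k < n
  k<n = <-≤-trans (m<m+n k (*-mono-≤ 1≤q (s≤s (z≤n {k₁})))) fits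
    where
    1≤q : 1 ≤ q
    1≤q = ≤-trans (s≤s z≤n) large

  few : (2 + 2 * (k * (q * k))) * 2 < k * n
  few = <-≤-trans (begin-strict
    -- Padding by 68 raises the constant 4 to 72 = 4 * 18, matching the 18 in `large`.
    (2 + 2 * (k * (q * k))) * 2         <⟨ m<m+n _ (s≤s z≤n) ⟩
    (2 + 2 * (k * (q * k))) * 2 + 68    ≡⟨ shape k q ⟩
    4 * (k * (q * k)) + 72 * 1          ≤⟨ +-monoʳ-≤ (4 * (k * (q * k))) (*-monoʳ-≤ 72 1≤kq) ⟩
    4 * (k * (q * k)) + 72 * (k * q)    ≡⟨ factor k q ⟩
    k * (4 * (q * (k + 18)))            ≤⟨ *-monoʳ-≤ k (*-monoʳ-≤ 4 (*-monoʳ-≤ q large)) ⟩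
    k * (4 * (q * q)) ∎) (*-monoʳ-≤ k lower)
    where
    1≤kq : 1 ≤ k * q
    1≤kq = *-mono-≤ (s≤s (z≤n {k₁})) (≤-trans (s≤s z≤n) large)
    shape : ∀ k q → (2 + 2 * (k * (q * k))) * 2 + 68 ≡ 4 * (k * (q * k)) + 72 * 1
    shape = solve-∀
    factor : ∀ k q → 4 * (k * (q * k)) + 72 * (k * q) ≡ k * (4 * (q * (k + 18)))
    factor = solve-∀

  slack : 2 + (suc (2 * (k * (q * k))) * 2 + (3 * ((4 * q + 9) * k₁) + 2 * (k * k₁)) + 4)
          ≤ k * (10 * (k * q))
  slack = begin
    2 + (suc (2 * (k * (q * k))) * 2 + (3 * ((4 * q + 9) * k₁) + 2 * (k * k₁)) + 4)
      ≡⟨ isolate k₁ q ⟩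
    23 * k₁ + rest k₁ q
      -- Of the linear term `29 * k₁` only 6 parts fit under the right side; the other 23 are raised
      -- to degree two, so that after `q≡` the difference has no negative coefficient.
      ≤⟨ +-monoˡ-≤ (rest k₁ q) (*-monoʳ-≤ 23 (square k₁)) ⟩
    23 * (k₁ * k₁) + rest k₁ q
      ≡⟨ cong (λ q → 23 * (k₁ * k₁) + rest k₁ q) q≡ ⟩
    23 * (k₁ * k₁) + rest k₁ (k + 18 + r)
      ≤⟨ m≤m+n _ (6 * (k₁ * k₁ * k₁) + 89 * (k₁ * k₁) + 6 * (r * (k₁ * k₁)) + 106 + 6 * r) ⟩
    23 * (k₁ * k₁) + rest k₁ (k + 18 + r)
      + (6 * (k₁ * k₁ * k₁) + 89 * (k₁ * k₁) + 6 * (r * (k₁ * k₁)) + 106 + 6 * r)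
      ≡⟨ surplus k₁ r ⟩
    k * (10 * (k * (k + 18 + r)))
      ≡⟨ cong (λ q → k * (10 * (k * q))) q≡ ⟨
    k * (10 * (k * q)) ∎
    where
    rest : ℕ → ℕ → ℕ
    rest k₁ q = 8 + 4 * (suc k₁ * (q * suc k₁)) + 12 * (q * k₁) + 6 * k₁ + 2 * (k₁ * k₁)
    square : ∀ m → m ≤ m * m
    square zero = z≤n
    square (suc m) = m≤m*n (suc m) (suc m)
    isolate : ∀ k₁ q →
      2 + (suc (2 * (suc k₁ * (q * suc k₁))) * 2 + (3 * ((4 * q + 9) * k₁) + 2 * (suc k₁ * k₁)) + 4)
      ≡ 23 * k₁ + (8 + 4 * (suc k₁ * (q * suc k₁)) + 12 * (q * k₁) + 6 * k₁ + 2 * (k₁ * k₁))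
    isolate = solve-∀
    surplus : ∀ k₁ r →
      23 * (k₁ * k₁) + (8 + 4 * (suc k₁ * ((suc k₁ + 18 + r) * suc k₁))
        + 12 * ((suc k₁ + 18 + r) * k₁) + 6 * k₁ + 2 * (k₁ * k₁))
      + (6 * (k₁ * k₁ * k₁) + 89 * (k₁ * k₁) + 6 * (r * (k₁ * k₁)) + 106 + 6 * r)
      ≡ suc k₁ * (10 * (suc k₁ * (suc k₁ + 18 + r)))
    surplus = solve-∀

  -- The bound 5 k n^(3/2) on `10 * (k * q) * n`, squared to stay in `ℕ`: 100 splits into 25 times
  -- 4, and `4 * (q * q) ≤ n`.
  deficit : (10 * (k * q) * n) ^ 2 ≤ 25 * k ^ 2 * n ^ 3
  deficit = begin
    (10 * (k * q) * n) ^ 2                 ≡⟨ expand k q n ⟩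
    25 * (k * k) * (n * n * (4 * (q * q))) ≤⟨ *-monoʳ-≤ (25 * (k * k)) (*-monoʳ-≤ (n * n) lower) ⟩
    25 * (k * k) * (n * n * n)             ≡⟨ powers k n ⟩
    25 * k ^ 2 * n ^ 3                     ∎
    where
    expand : ∀ k q n → 10 * (k * q) * n * (10 * (k * q) * n * 1) ≡ 25 * (k * k) * (n * n * (4 * (q * q)))
    expand = solve-∀
    powers : ∀ k n → 25 * (k * k) * (n * n * n) ≡ 25 * (k * (k * 1)) * (n * (n * (n * 1)))
    powers = solve-∀

theorem1p1 : ∀ (k : ℕ) → 1 ≤ k → ∃ λ (n₀ : ℕ) → ∀ (n : ℕ) → n₀ ≤ n →
    ∀ (first : Player) → ∃ λ (t : ℕ) →
    MaxForces k n first [] t × ((n C 2) ∸ t) ^ 2 ≤ 25 * k ^ 2 * n ^ 3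
-- From this bound on, `half-sqrt` returns a `q` with `k₀ ≤ q`, as `Parameters` requires.
theorem1p1 (suc k₁) _ = 4 * (k₀ * k₀) , forces
  where
  k₀ = suc k₁ + 18

  forces : ∀ n → 4 * (k₀ * k₀) ≤ n → ∀ first → ∃ λ t →
    MaxForces (suc k₁) n first [] t × ((n C 2) ∸ t) ^ 2 ≤ 25 * suc k₁ ^ 2 * n ^ 3
  forces n n₀≤n first with half-sqrt n
  ... | q , lower , upper = goal , max-forces-goal first ,
    -- `goal` is a truncated difference, so `n C 2 ≤ goal + s * n` holds even if `s * n` exceeds
    -- `n C 2`.
    ≤-trans (^-monoˡ-≤ 2 (m≤n+o⇒m∸n≤o (n C 2) goal
      (≤-trans (m≤n+m∸n (n C 2) (s * n)) (≤-reflexive (+-comm (s * n) goal))))) deficit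
    where
    s = 10 * (suc k₁ * q)

    large : k₀ ≤ q
    large with k₀ ℕ.≤? q
    ... | yes k₀≤q = k₀≤q
    ... | no k₀≰q = ⊥-elim (<⇒≱ upper
      (≤-trans (*-monoʳ-≤ 4 (*-mono-≤ (≰⇒> k₀≰q) (≰⇒> k₀≰q))) n₀≤n))

    open Parameters {k₁} lower upper large
    open Strategy {k₁} (layout {k = suc k₁} {D = 4 * q + 9} fits covers
      (Fin.fromℕ< (<-≤-trans (s≤s z≤n) large))) s using (module Game)
    open Game k<n few slack using (goal; max-forces-goal)
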